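{- Let $\alpha$ and $\beta$ be dotted compositions. Then the monomial quasisymmetric functions in superspace multiply as $$M_\alpha M_\beta=\sum_P\operatorname{sign}(P)\,M_{\Gamma(P)},$$ where the sum is over all $(\alpha,\beta)$ overlapping shuffles $P$ and $\operatorname{sign}(P)=(-1)^{d(P)}$, with $d(P)$ the number of dots below the path $P$.
   Context: Variables $x_1,x_2,\dots$ commute; $\theta_1,\theta_2,\dots$ anticommute ($\theta_i\theta_j=-\theta_j\theta_i$, $\theta_i^2=0$) and commute with the $x$'s; coefficients are in $\mathbb Q$. A dotted composition $\alpha=(\alpha_1,\dots,\alpha_l)$ is a finite sequence whose entries belong to $\{1,2,3,\dots\}$ (non-dotted) or $\{\dot0,\dot1,\dot2,\dots\}$ (dotted); its length is $\ell(\alpha)=l$. Put $\eta_i=1$ if $\alpha_i$ is dotted and $\eta_i=0$ otherwise. The monomial quasisymmetric function in superspace is $$M_\alpha=\sum_{i_1<i_2<\cdots<i_l}\theta_{i_1}^{\eta_1}\cdots\theta_{i_l}^{\eta_l}\,x_{i_1}^{\alpha_1}\cdots x_{i_l}^{\alpha_l},$$ where dots are ignored in the exponents of the $x$'s, and $M_\emptyset=1$. For $\alpha$ of length $\ell$ and $\beta$ of length $\ell'$, consider the grid of unit cells in $[0,\ell]\times[0,\ell']$; columns are labelled $q=1,\dots,\ell$ from left to right by the parts $\alpha_q$, and rows $p=1,\dots,\ell'$ from bottom to top by the parts $\beta_p$. A dot is placed in (the centre of) the cell in row $p$ and column $q$ whenever $\alpha_q$ and $\beta_p$ are both dotted. An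 $(\alpha,\beta)$ overlapping shuffle is a lattice path $P$ from $(0,0)$ to $(\ell,\ell')$ with steps $(1,0)$, $(0,1)$ and $(1,1)$ that takes no diagonal step across a cell containing a dot. The dotted composition $\Gamma(P)=\gamma$ has one part per step: if the $h$-th step is horizontal over column $q$, $\gamma_h=\alpha_q$; if it is vertical over row $p$, $\gamma_h=\beta_p$; if it is diagonal over the cell in row $p$, column $q$, $\gamma_h=\alpha_q+\beta_p$, dotted if one of $\alpha_q,\beta_p$ is dotted. In the first two cases $\gamma_h$ is dotted exactly when the corresponding part is. -}

module Defs where

open import Data.Bool.Base using (Bool; true; false; if_then_else_; T)
import Data.Bool.Properties as Bool
open import Data.Empty using (⊥; ⊥-elim-irr)
open import Data.Fin.Base using (Fin; zero; suc; toℕ)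
open import Data.List.Base
  using (List; []; _∷_; _++_; map; foldr; length; lookup; filter; upTo; allFin;
         cartesianProduct; cartesianProductWith)
open import Data.List.Membership.Propositional using (_∈_)
open import Data.List.Membership.Propositional.Properties
  using (∈-map⁺; ∈-map⁻; ∈-++⁺ˡ; ∈-++⁺ʳ; ∈-++⁻)
open import Data.List.Properties using (map-++; map-∘; map-cong)
open import Data.List.Relation.Unary.All using ([])
open import Data.List.Relation.Unary.Any using (here)
open import Data.List.Relation.Unary.AllPairs using ([]; _∷_)
open import Data.List.Relation.Unary.Unique.Propositional using (Unique)
import Data.List.Relation.Unary.Unique.Propositional.Properties as Unique
open import Data.Nat.Base as ℕ using (ℕ; zero; suc; NonZero)
import Data.Nat.Properties as ℕ
open import Data.Product.Base using (∃; _×_; _,_)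
open import Data.Product.Properties using () renaming (≡-dec to ×-≡-dec)
open import Data.Rational.Base using (ℚ; 0ℚ; 1ℚ; _+_; _*_; -_; +-*-rawSemiring)
import Data.Rational.Properties as ℚ
open import Data.Sum.Base using (_⊎_; inj₁; inj₂)
open import Data.Vec.Base as Vec using (Vec; []; _∷_; _∷ʳ_; _[_]≔_)
import Data.Vec.Properties as Vec
open import Function.Base using (_∘_)
open import Relation.Binary.Definitions using (DecidableEquality)
open import Relation.Binary.PropositionalEquality
  using (_≡_; _≢_; refl; sym; trans; cong; cong₂; module ≡-Reasoning)
open import Relation.Nullary.Decidable using (Dec; yes; no; does; T?; _×-dec_; dec-false)
open import Relation.Nullary.Negation.Core using (¬_)

open import Algebra.Definitions.RawSemiring +-*-rawSemiring public using (_^_)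

------------------------------------------------------------------------
-- Dotted compositions

data Part : Set where
  plain  : (a : ℕ) → .{{NonZero a}} → Part
  dotted : ℕ → Part

DottedComposition : Set
DottedComposition = List Part

value : Part → ℕ
value (plain a)  = a
value (dotted a) = a

η : Part → Bool
η (plain _)  = false
η (dotted _) = true

Dotted : Part → Set
Dotted p = T (η p)

+-nonZero : ∀ a b → .{{NonZero a}} → NonZero (a ℕ.+ b)
+-nonZero (suc a) b = _

-- The last clause of _⊕_ is never used: overlapping shuffles do not add two
-- dotted parts.
_⊕_ : Part → Part → Part
plain a  ⊕ plain b  = plain (a ℕ.+ b) {{+-nonZero a b}}
plain a  ⊕ dotted b = dotted (a ℕ.+ b)
dotted a ⊕ plain b  = dotted (a ℕ.+ b)
dotted a ⊕ dotted b = dotted (a ℕ.+ b)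

------------------------------------------------------------------------
-- Monomials in x₁,…,xₙ,θ₁,…,θₙ

-- (a , e) stands for θᵉ xᵃ, with e read as 0 or 1.
Power : Set
Power = ℕ × Bool

1ₚ : Power
1ₚ = 0 , false

-- [(a₁ , e₁), …, (aₙ , eₙ)] is the basis monomial θ₁^e₁⋯θₙ^eₙ x₁^a₁⋯xₙ^aₙ,
-- its θ's being in increasing order.
Monomial : ℕ → Set
Monomial n = Vec Power n

_≟ₘ_ : ∀ {n} → DecidableEquality (Monomial n)
_≟ₘ_ = Vec.≡-dec (×-≡-dec ℕ._≟_ Bool._≟_)

degθ : ∀ {n} → Monomial n → ℕ
degθ []            = 0
degθ ((_ , e) ∷ u) = (if e then 1 else 0) ℕ.+ degθ u

-- The number of pairs i > j with θᵢ occurring in u and θⱼ in v, that is, of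
-- transpositions needed to sort the θ's of the product u v.
inversions : ∀ {n} → Monomial n → Monomial n → ℕ
inversions []      []            = 0
inversions (_ ∷ u) ((_ , e) ∷ v) = (if e then degθ u else 0) ℕ.+ inversions u v

-- θ² = 0, so θ factors in only two ways.
splitθ : Bool → List (Bool × Bool)
splitθ false = (false , false) ∷ []
splitθ true  = (true , false) ∷ (false , true) ∷ []

splitPower : Power → List (Power × Power)
splitPower (a , e) =
  cartesianProductWith (λ b (e₁ , e₂) → (b , e₁) , (a ℕ.∸ b , e₂))
                       (upTo (suc a)) (splitθ e)

-- All pairs (u , v) of basis monomials with u v = ± m.
factorisations : ∀ {n} → Monomial n → List (Monomial n × Monomial n)
factorisations []      = ([] , []) ∷ []
factorisations (p ∷ m) =
  cartesianProductWith (λ (p₁ , p₂) (u , v) → p₁ ∷ u , p₂ ∷ v)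
                       (splitPower p) (factorisations m)

------------------------------------------------------------------------
-- Formal power series in superspace

∑ : ∀ {A : Set} → List A → (A → ℚ) → ℚ
∑ xs f = foldr _+_ 0ℚ (map f xs)

-- A monomial in the first n pairs of variables is also one in the first
-- suc n pairs; stable says that its coefficient does not depend on this
-- choice. Series are formal: any assignment of coefficients is allowed.
record Series : Set where
  field
    coeff  : ∀ {n} → Monomial n → ℚ
    stable : ∀ {n} (m : Monomial n) → coeff (m ∷ʳ 1ₚ) ≡ coeff m

open Series public

infix 4 _≈_
_≈_ : Series → Series → Set
F ≈ G = ∀ {n} (m : Monomial n) → coeff F m ≡ coeff G m

0ₛ : Series
0ₛ = record { coeff = λ _ → 0ℚ ; stable = λ _ → refl }

infixl 6 _+ₛ_
_+ₛ_ : Series → Series → Series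
F +ₛ G = record
  { coeff  = λ m → coeff F m + coeff G m
  ; stable = λ m → cong₂ _+_ (stable F m) (stable G m)
  }

infixr 8 _•_
_•_ : ℚ → Series → Series
c • F = record
  { coeff  = λ m → c * coeff F m
  ; stable = λ m → cong (c *_) (stable F m)
  }

∑ₛ : ∀ {A : Set} → List A → (A → Series) → Series
∑ₛ xs F = foldr _+ₛ_ 0ₛ (map F xs)

∑-cong : ∀ {A : Set} (xs : List A) {f g : A → ℚ} → (∀ x → f x ≡ g x) → ∑ xs f ≡ ∑ xs g
∑-cong xs eq = cong (foldr _+_ 0ℚ) (map-cong eq xs)

∑-map : ∀ {A B : Set} (xs : List A) (h : A → B) (f : B → ℚ) → ∑ (map h xs) f ≡ ∑ xs (f ∘ h)
∑-map xs h f = cong (foldr _+_ 0ℚ) (sym (map-∘ xs))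

∑-++ : ∀ {A : Set} (xs ys : List A) (f : A → ℚ) → ∑ (xs ++ ys) f ≡ ∑ xs f + ∑ ys f
∑-++ []       ys f = sym (ℚ.+-identityˡ _)
∑-++ (x ∷ xs) ys f = trans (cong (f x +_) (∑-++ xs ys f)) (sym (ℚ.+-assoc (f x) _ _))

extend : ∀ {n} → Monomial n × Monomial n → Monomial (suc n) × Monomial (suc n)
extend (u , v) = u ∷ʳ 1ₚ , v ∷ʳ 1ₚ

cpw-map : ∀ {A B B′ C C′ : Set} (f : A → B → C) (f′ : A → B′ → C′) (g : B → B′) (h : C → C′) →
          (∀ a b → f′ a (g b) ≡ h (f a b)) → ∀ xs ys →
          cartesianProductWith f′ xs (map g ys) ≡ map h (cartesianProductWith f xs ys)
cpw-map f f′ g h eq []       ys = refl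
cpw-map f f′ g h eq (x ∷ xs) ys = begin
  map (f′ x) (map g ys) ++ cartesianProductWith f′ xs (map g ys)
    ≡⟨ cong₂ _++_ (trans (sym (map-∘ ys)) (trans (map-cong (eq x) ys) (map-∘ ys)))
                  (cpw-map f f′ g h eq xs ys) ⟩
  map h (map (f x) ys) ++ map h (cartesianProductWith f xs ys)
    ≡⟨ map-++ h (map (f x) ys) _ ⟨
  map h (cartesianProductWith f (x ∷ xs) ys) ∎
  where open ≡-Reasoning

factorisations-∷ʳ : ∀ {n} (m : Monomial n) →
                    factorisations (m ∷ʳ 1ₚ) ≡ map extend (factorisations m)
factorisations-∷ʳ []      = refl
factorisations-∷ʳ (p ∷ m) = trans
  (cong (cartesianProductWith _ (splitPower p)) (factorisations-∷ʳ m))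
  (cpw-map _ _ extend extend (λ _ _ → refl) (splitPower p) (factorisations m))

degθ-∷ʳ : ∀ {n} (u : Monomial n) → degθ (u ∷ʳ 1ₚ) ≡ degθ u
degθ-∷ʳ []            = refl
degθ-∷ʳ ((_ , e) ∷ u) = cong ((if e then 1 else 0) ℕ.+_) (degθ-∷ʳ u)

inversions-∷ʳ : ∀ {n} (u v : Monomial n) → inversions (u ∷ʳ 1ₚ) (v ∷ʳ 1ₚ) ≡ inversions u v
inversions-∷ʳ []      []                = refl
inversions-∷ʳ (_ ∷ u) ((_ , false) ∷ v) = inversions-∷ʳ u v
inversions-∷ʳ (_ ∷ u) ((_ , true) ∷ v)  = cong₂ ℕ._+_ (degθ-∷ʳ u) (inversions-∷ʳ u v)

mulTerm : ∀ {n} → Series → Series → Monomial n × Monomial n → ℚ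
mulTerm F G (u , v) = (- 1ℚ) ^ inversions u v * (coeff F u * coeff G v)

infixl 7 _*ₛ_
_*ₛ_ : Series → Series → Series
F *ₛ G = record
  { coeff  = λ m → ∑ (factorisations m) (mulTerm F G)
  ; stable = λ m → begin
      ∑ (factorisations (m ∷ʳ 1ₚ)) (mulTerm F G)
        ≡⟨ cong (λ l → ∑ l (mulTerm F G)) (factorisations-∷ʳ m) ⟩
      ∑ (map extend (factorisations m)) (mulTerm F G)
        ≡⟨ ∑-map (factorisations m) extend (mulTerm F G) ⟩
      ∑ (factorisations m) (mulTerm F G ∘ extend)
        ≡⟨ ∑-cong (factorisations m) (λ (u , v) →
             cong₂ (λ k c → (- 1ℚ) ^ k * c) (inversions-∷ʳ u v)
                   (cong₂ _*_ (stable F u) (stable G v))) ⟩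
      ∑ (factorisations m) (mulTerm F G) ∎
  }
  where open ≡-Reasoning

------------------------------------------------------------------------
-- Monomial quasisymmetric functions in superspace

-- All index sequences i₁ < i₂ < ⋯ < iₗ from the first n indices.
increasing : ∀ l n → List (Vec (Fin n) l)
increasing zero    n       = [] ∷ []
increasing (suc l) zero    = []
increasing (suc l) (suc n) =
  map (λ is → zero ∷ Vec.map suc is) (increasing l n) ++ map (Vec.map suc) (increasing (suc l) n)

power : Part → Power
power p = value p , η p

-- For i₁ < ⋯ < iₗ, the monomial θ_{i₁}^η₁⋯θ_{iₗ}^ηₗ x_{i₁}^α₁⋯x_{iₗ}^αₗ.
term : ∀ {n} (α : DottedComposition) → Vec (Fin n) (length α) → Monomial n
term []      []       = Vec.replicate _ 1ₚ
term (a ∷ α) (i ∷ is) = term α is [ i ]≔ power a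

δ : ∀ {n} → Monomial n → Monomial n → ℚ
δ u v = if does (u ≟ₘ v) then 1ℚ else 0ℚ

-- Only index sequences with iₗ ≤ n are summed: every part contributes a
-- positive power of x or a θ, so that the other terms of M_α involve a
-- variable which does not occur in m.
coeffM : DottedComposition → ∀ {n} → Monomial n → ℚ
coeffM α {n} m = ∑ (increasing (length α) n) (λ is → δ (term α is) m)

power≢1 : ∀ p → power p ≢ 1ₚ
power≢1 (plain (suc a)) ()
power≢1 (dotted a)      ()

term-suc : ∀ {n} α (is : Vec (Fin n) (length α)) → term α (Vec.map suc is) ≡ 1ₚ ∷ term α is
term-suc []      []       = refl
term-suc (a ∷ α) (i ∷ is) = cong (_[ suc i ]≔ power a) (term-suc α is)

δ₁ : Power → Power → ℚ
δ₁ p q = if does (×-≡-dec ℕ._≟_ Bool._≟_ p q) then 1ℚ else 0ℚ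

δ-split : ∀ {n} p q (u v : Monomial n) → δ (p ∷ u) (q ∷ v) ≡ δ₁ p q * δ u v
δ-split p q u v with ×-≡-dec ℕ._≟_ Bool._≟_ p q
... | no _  = sym (ℚ.*-zeroˡ (δ u v))
... | yes _ with u ≟ₘ v
...   | yes _ = refl
...   | no _  = refl

∑-* : ∀ {A : Set} (xs : List A) c (f : A → ℚ) → ∑ xs (λ x → c * f x) ≡ c * ∑ xs f
∑-* []       c f = sym (ℚ.*-zeroʳ c)
∑-* (x ∷ xs) c f = trans (cong (c * f x +_) (∑-* xs c f)) (sym (ℚ.*-distribˡ-+ c (f x) _))

coeffM-[] : ∀ {n} q (m : Monomial n) → coeffM [] (q ∷ m) ≡ δ₁ 1ₚ q * coeffM [] m
coeffM-[] {n} q m = begin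
  δ (term [] []) (q ∷ m) + 0ℚ   ≡⟨ cong (_+ 0ℚ) (δ-split 1ₚ q (term [] []) m) ⟩
  c * δ (term [] []) m + 0ℚ     ≡⟨ cong (c * δ (term [] []) m +_) (ℚ.*-zeroʳ c) ⟨
  c * δ (term [] []) m + c * 0ℚ ≡⟨ ℚ.*-distribˡ-+ c (δ (term [] []) m) 0ℚ ⟨
  c * coeffM [] m               ∎
  where
  open ≡-Reasoning
  c = δ₁ 1ₚ q

coeffM-∷ : ∀ a α {n} q (m : Monomial n) →
           coeffM (a ∷ α) (q ∷ m) ≡ δ₁ (power a) q * coeffM α m + δ₁ 1ₚ q * coeffM (a ∷ α) m
coeffM-∷ a α {n} q m = begin
  ∑ (map (λ is → zero ∷ Vec.map suc is) I ++ map (Vec.map suc) J) f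
    ≡⟨ ∑-++ (map (λ is → zero ∷ Vec.map suc is) I) _ f ⟩
  ∑ (map (λ is → zero ∷ Vec.map suc is) I) f + ∑ (map (Vec.map suc) J) f
    ≡⟨ cong₂ _+_ (∑-map I _ f) (∑-map J _ f) ⟩
  ∑ I (λ is → f (zero ∷ Vec.map suc is)) + ∑ J (λ is → f (Vec.map suc is))
    ≡⟨ cong₂ _+_
         (∑-cong I λ is → trans (cong (λ u → δ (u [ zero ]≔ power a) (q ∷ m)) (term-suc α is))
                                (δ-split (power a) q (term α is) m))
         (∑-cong J λ is → trans (cong (λ u → δ u (q ∷ m)) (term-suc (a ∷ α) is))
                                (δ-split 1ₚ q (term (a ∷ α) is) m)) ⟩
  ∑ I (λ is → δ₁ (power a) q * δ (term α is) m) +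
  ∑ J (λ is → δ₁ 1ₚ q * δ (term (a ∷ α) is) m)
    ≡⟨ cong₂ _+_ (∑-* I (δ₁ (power a) q) (λ is → δ (term α is) m))
                 (∑-* J (δ₁ 1ₚ q) (λ is → δ (term (a ∷ α) is) m)) ⟩
  δ₁ (power a) q * coeffM α m + δ₁ 1ₚ q * coeffM (a ∷ α) m ∎
  where
  open ≡-Reasoning
  I = increasing (length α) n
  J = increasing (suc (length α)) n
  f : Vec (Fin (suc n)) (suc (length α)) → ℚ
  f is = δ (term (a ∷ α) is) (q ∷ m)

δ₁-power : ∀ a → δ₁ (power a) 1ₚ ≡ 0ℚ
δ₁-power a = cong (λ b → if b then 1ℚ else 0ℚ)
                  (dec-false (×-≡-dec ℕ._≟_ Bool._≟_ (power a) 1ₚ) (power≢1 a))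

coeffM-stable : ∀ α {n} (m : Monomial n) → coeffM α (m ∷ʳ 1ₚ) ≡ coeffM α m
coeffM-stable []      []      = refl
coeffM-stable (a ∷ α) []      = trans (coeffM-∷ a α 1ₚ [])
  (trans (cong (λ c → c * coeffM α [] + 1ℚ * 0ℚ) (δ₁-power a))
         (trans (cong (_+ 1ℚ * 0ℚ) (ℚ.*-zeroˡ (coeffM α []))) refl))
coeffM-stable []      (q ∷ m) = trans (coeffM-[] q (m ∷ʳ 1ₚ))
  (trans (cong (δ₁ 1ₚ q *_) (coeffM-stable [] m)) (sym (coeffM-[] q m)))
coeffM-stable (a ∷ α) (q ∷ m) = trans (coeffM-∷ a α q (m ∷ʳ 1ₚ))
  (trans (cong₂ (λ c d → δ₁ (power a) q * c + δ₁ 1ₚ q * d)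
                (coeffM-stable α m) (coeffM-stable (a ∷ α) m))
         (sym (coeffM-∷ a α q m)))

M : DottedComposition → Series
M α = record { coeff = coeffM α ; stable = coeffM-stable α }

------------------------------------------------------------------------
-- Overlapping shuffles

-- Lattice paths from the lower left to the upper right corner of the grid
-- whose columns (left to right) and rows (bottom to top) are labelled by α
-- and β. After its first step, a path is a path in the remaining grid. The
-- proof in diag says that the crossed cell contains no dot.
data OverlappingShuffle : (α β : DottedComposition) → Set where
  end   : OverlappingShuffle [] []
  right : ∀ {a α β} → OverlappingShuffle α β → OverlappingShuffle (a ∷ α) β
  up    : ∀ {b α β} → OverlappingShuffle α β → OverlappingShuffle α (b ∷ β)
  diag  : ∀ {a b α β} → .(¬ (Dotted a × Dotted b)) →
          OverlappingShuffle α β → OverlappingShuffle (a ∷ α) (b ∷ β)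

Γ : ∀ {α β} → OverlappingShuffle α β → DottedComposition
Γ end                = []
Γ (right {a = a} P)  = a ∷ Γ P
Γ (up {b = b} P)     = b ∷ Γ P
Γ (diag {a} {b} _ P) = (a ⊕ b) ∷ Γ P

-- The ordinate at which P enters the column q, by a horizontal or a diagonal
-- step.
height : ∀ {α β} → OverlappingShuffle α β → Fin (length α) → ℕ
height (right P)  zero    = 0
height (right P)  (suc q) = height P q
height (up P)     q       = suc (height P q)
height (diag _ P) zero    = 0
height (diag _ P) (suc q) = suc (height P q)

-- A cell is given by its column q and its row p, both counted from 0.
Cell : (α β : DottedComposition) → Set
Cell α β = Fin (length α) × Fin (length β)

HasDot : ∀ {α β} → Cell α β → Set
HasDot {α} {β} (q , p) = Dotted (lookup α q) × Dotted (lookup β p)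

-- The centre of the cell has ordinate p + 1/2. Above it, P has ordinate
-- height P q (horizontal step) or height P q + 1/2 (diagonal step), so in both
-- cases the centre is strictly below P exactly when p < height P q.
Below : ∀ {α β} → OverlappingShuffle α β → Cell α β → Set
Below P (q , p) = toℕ p ℕ.< height P q

DotBelow : ∀ {α β} → OverlappingShuffle α β → Cell α β → Set
DotBelow {α} {β} P c = HasDot {α} {β} c × Below P c

dotBelow? : ∀ {α β} (P : OverlappingShuffle α β) (c : Cell α β) → Dec (DotBelow P c)
dotBelow? {α} {β} P (q , p) =
  (T? (η (lookup α q)) ×-dec T? (η (lookup β p))) ×-dec (toℕ p ℕ.<? height P q)

dotsBelow : ∀ {α β} → OverlappingShuffle α β → ℕ
dotsBelow {α} {β} P =
  length (filter (dotBelow? P) (cartesianProduct (allFin (length α)) (allFin (length β))))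

sign : ∀ {α β} → OverlappingShuffle α β → ℚ
sign P = (- 1ℚ) ^ dotsBelow P

overlappingShuffles : ∀ α β → List (OverlappingShuffle α β)
diagonals : ∀ {a b} α β → Dec (Dotted a × Dotted b) → List (OverlappingShuffle (a ∷ α) (b ∷ β))

overlappingShuffles []      []      = end ∷ []
overlappingShuffles []      (b ∷ β) = map up (overlappingShuffles [] β)
overlappingShuffles (a ∷ α) []      = map right (overlappingShuffles α [])
overlappingShuffles (a ∷ α) (b ∷ β) =
  map right (overlappingShuffles α (b ∷ β)) ++
  map up (overlappingShuffles (a ∷ α) β) ++
  diagonals α β (T? (η a) ×-dec T? (η b))

diagonals α β (yes _)   = []
diagonals α β (no ¬dot) = map (diag ¬dot) (overlappingShuffles α β)

∈-overlappingShuffles : ∀ {α β} (P : OverlappingShuffle α β) → P ∈ overlappingShuffles α β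
∈-diagonals : ∀ {a b α β} (d : Dec (Dotted a × Dotted b)) .(¬dot : ¬ (Dotted a × Dotted b))
              (P : OverlappingShuffle α β) → diag ¬dot P ∈ diagonals α β d

∈-overlappingShuffles end = here refl
∈-overlappingShuffles {_ ∷ _} {[]}    (right P) = ∈-map⁺ right (∈-overlappingShuffles P)
∈-overlappingShuffles {_ ∷ _} {_ ∷ _} (right P) = ∈-++⁺ˡ (∈-map⁺ right (∈-overlappingShuffles P))
∈-overlappingShuffles {[]}    {_ ∷ _} (up P) = ∈-map⁺ up (∈-overlappingShuffles P)
∈-overlappingShuffles {a ∷ α} {b ∷ β} (up P) =
  ∈-++⁺ʳ (map right (overlappingShuffles α (b ∷ β))) (∈-++⁺ˡ (∈-map⁺ up (∈-overlappingShuffles P)))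
∈-overlappingShuffles {a ∷ α} {b ∷ β} (diag ¬dot P) =
  ∈-++⁺ʳ (map right (overlappingShuffles α (b ∷ β)))
    (∈-++⁺ʳ (map up (overlappingShuffles (a ∷ α) β))
      (∈-diagonals (T? (η a) ×-dec T? (η b)) ¬dot P))

∈-diagonals (yes dot) ¬dot P = ⊥-elim-irr (¬dot dot)
∈-diagonals (no _)    ¬dot P = ∈-map⁺ (diag _) (∈-overlappingShuffles P)

overlappingShuffles-unique : ∀ α β → Unique (overlappingShuffles α β)
diagonals-unique : ∀ {a b} α β (d : Dec (Dotted a × Dotted b)) → Unique (diagonals α β d)

overlappingShuffles-unique []      []      = [] ∷ []
overlappingShuffles-unique []      (b ∷ β) =
  Unique.map⁺ (λ { refl → refl }) (overlappingShuffles-unique [] β)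
overlappingShuffles-unique (a ∷ α) []      =
  Unique.map⁺ (λ { refl → refl }) (overlappingShuffles-unique α [])
overlappingShuffles-unique (a ∷ α) (b ∷ β) =
  Unique.++⁺ (Unique.map⁺ (λ { refl → refl }) (overlappingShuffles-unique α (b ∷ β)))
    (Unique.++⁺ (Unique.map⁺ (λ { refl → refl }) (overlappingShuffles-unique (a ∷ α) β))
      (diagonals-unique α β d)
      λ (u , v) → up∉ d (∈-map⁻ up u) v)
    λ (r , s) → right∉ (∈-map⁻ right r) (∈-++⁻ (map up (overlappingShuffles (a ∷ α) β)) s)
  where
  d = T? (η a) ×-dec T? (η b)

  up∉ : ∀ {P} (e : Dec (Dotted a × Dotted b)) →
        (∃ λ Q → Q ∈ overlappingShuffles (a ∷ α) β × P ≡ up Q) → P ∈ diagonals α β e → ⊥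
  up∉ (no ¬dot) (_ , _ , refl) v with ∈-map⁻ (diag ¬dot) v
  ... | _ , _ , ()

  right∉diag : ∀ {P} (e : Dec (Dotted a × Dotted b)) →
        (∃ λ Q → Q ∈ overlappingShuffles α (b ∷ β) × P ≡ right Q) → P ∈ diagonals α β e → ⊥
  right∉diag (no ¬dot) (_ , _ , refl) v with ∈-map⁻ (diag ¬dot) v
  ... | _ , _ , ()

  right∉ : ∀ {P} → (∃ λ Q → Q ∈ overlappingShuffles α (b ∷ β) × P ≡ right Q) →
           (P ∈ map up (overlappingShuffles (a ∷ α) β)) ⊎ (P ∈ diagonals α β d) → ⊥
  right∉ (_ , _ , refl) (inj₁ s) with ∈-map⁻ up s
  ... | _ , _ , ()
  right∉ r (inj₂ s) = right∉diag d r s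

diagonals-unique α β (yes _)   = []
diagonals-unique α β (no ¬dot) =
  Unique.map⁺ (λ { refl → refl }) (overlappingShuffles-unique α β)

{-# OPTIONS --safe #-}

-- Both sides satisfy the same recursion in the first pair of variables
-- (x₁, θ₁). On the left, (x₁, θ₁) carries the first part of α, the first part
-- of β, both or neither. On the right, it carries the first part of Γ P, which
-- is given by the first step of P, or nothing. A dotted first part b of β is
-- moved past the θ's of what remains of α; this is the sign of the dots of the
-- first row below P, when b is used by the first step.

module Submission where

open import Defs

open import Algebra.Bundles using (CommutativeRing)
open import Data.Bool.Base using (Bool; true; false; if_then_else_; _∧_; _∨_)
import Data.Bool.Properties as Bool
open import Data.Fin.Base using (Fin; zero; suc; toℕ)
open import Data.List.Base
  using (List; []; _∷_; _++_; map; length; lookup; filter; upTo; tabulate;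
         cartesianProduct; cartesianProductWith)
open import Data.List.Properties using (filter-++; length-++; map-upTo)
open import Data.Nat.Base as ℕ using (ℕ; zero; suc; _≡ᵇ_)
import Data.Nat.Properties as ℕ
open import Data.Product.Base using (_×_; _,_; proj₂)
open import Data.Product.Properties using () renaming (≡-dec to ×-≡-dec)
open import Data.Rational.Base using (ℚ; 0ℚ; 1ℚ; _+_; _*_; -_)
import Data.Rational.Properties as ℚ
open import Data.Rational.Solver using (module +-*-Solver)
open import Data.Sum.Base using (_⊎_; inj₁; inj₂)
open import Data.Unit.Base using (tt)
open import Data.Vec.Base using ([]; _∷_)
open import Function.Base using (_∘_)
open import Level using (0ℓ)
open import Relation.Binary.Definitions using (DecidableEquality)
open import Relation.Binary.PropositionalEquality
  using (_≡_; refl; sym; trans; cong; cong₂; module ≡-Reasoning)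
open import Relation.Nullary.Decidable using (Dec; yes; no; does; T?; _×-dec_)
open import Relation.Nullary.Negation.Core using (¬_; contradiction)
open import Relation.Unary using (Pred; Decidable)

open import Algebra.Properties.CommutativeMonoid.Sum ℕ.+-0-commutativeMonoid
  using (sum; ∑-distrib-+; sum-cong-≗; sum-replicate-zero)
open import Algebra.Properties.Semiring.Exp
  (CommutativeRing.semiring ℚ.+-*-commutativeRing) using (^-homo-*)
open import Algebra.Properties.CommutativeSemigroup
  (CommutativeRing.+-commutativeSemigroup ℚ.+-*-commutativeRing)
  using () renaming (interchange to +-interchange)
open import Algebra.Properties.CommutativeSemigroup
  (CommutativeRing.*-commutativeSemigroup ℚ.+-*-commutativeRing)
  using () renaming (interchange to *-interchange)

open ≡-Reasoning

private variable
  A B C : Set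

-- Finite sums

∑-zero : (xs : List A) {f : A → ℚ} → (∀ x → f x ≡ 0ℚ) → ∑ xs f ≡ 0ℚ
∑-zero []       f≡0 = refl
∑-zero (x ∷ xs) f≡0 = cong₂ _+_ (f≡0 x) (∑-zero xs f≡0)

∑-+ : (xs : List A) (f g : A → ℚ) → ∑ xs (λ x → f x + g x) ≡ ∑ xs f + ∑ xs g
∑-+ []       f g = refl
∑-+ (x ∷ xs) f g = trans (cong (f x + g x +_) (∑-+ xs f g)) (+-interchange (f x) (g x) _ _)

∑-*ʳ : (xs : List A) (f : A → ℚ) (c : ℚ) → ∑ xs (λ x → f x * c) ≡ ∑ xs f * c
∑-*ʳ xs f c = trans (∑-cong xs (λ x → ℚ.*-comm (f x) c)) (trans (∑-* xs c f) (ℚ.*-comm c _))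

∑-comm : (xs : List A) (ys : List B) (f : A → B → ℚ) →
         ∑ xs (λ x → ∑ ys (f x)) ≡ ∑ ys (λ y → ∑ xs (λ x → f x y))
∑-comm []       ys f = sym (∑-zero ys (λ _ → refl))
∑-comm (x ∷ xs) ys f = trans (cong (∑ ys (f x) +_) (∑-comm xs ys f)) (sym (∑-+ ys (f x) _))

∑-product : (xs : List A) (ys : List B) (f : A → ℚ) (g : B → ℚ) →
        ∑ xs (λ x → ∑ ys (λ y → f x * g y)) ≡ ∑ xs f * ∑ ys g
∑-product xs ys f g = trans (∑-cong xs (λ x → ∑-* ys (f x) g)) (∑-*ʳ xs f (∑ ys g))

∑-cartesianProductWith : (_∙_ : A → B → C) (xs : List A) (ys : List B) (f : C → ℚ) →
  ∑ (cartesianProductWith _∙_ xs ys) f ≡ ∑ xs (λ x → ∑ ys (λ y → f (x ∙ y)))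
∑-cartesianProductWith _∙_ []       ys f = refl
∑-cartesianProductWith _∙_ (x ∷ xs) ys f = trans (∑-++ (map (x ∙_) ys) _ f)
  (cong₂ _+_ (∑-map ys (x ∙_) f) (∑-cartesianProductWith _∙_ xs ys f))

coeff-∑ₛ : (xs : List A) (F : A → Series) → ∀ {n} (m : Monomial n) →
           coeff (∑ₛ xs F) m ≡ ∑ xs (λ x → coeff (F x) m)
coeff-∑ₛ []       F m = refl
coeff-∑ₛ (x ∷ xs) F m = cong (coeff (F x) m +_) (coeff-∑ₛ xs F m)

-- Products of powers

⟦_⟧ : Bool → ℚ
⟦ b ⟧ = if b then 1ℚ else 0ℚ

⟦∧⟧ : ∀ b c → ⟦ b ∧ c ⟧ ≡ ⟦ b ⟧ * ⟦ c ⟧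
⟦∧⟧ true  c = sym (ℚ.*-identityˡ ⟦ c ⟧)
⟦∧⟧ false c = sym (ℚ.*-zeroˡ ⟦ c ⟧)

does-×-≡-dec : (_≟₁_ : DecidableEquality A) (_≟₂_ : DecidableEquality B) → ∀ a b c d →
  does (×-≡-dec _≟₁_ _≟₂_ (a , c) (b , d)) ≡ does (a ≟₁ b) ∧ does (c ≟₂ d)
does-×-≡-dec _≟₁_ _≟₂_ a b c d with a ≟₁ b
... | no _     = refl
... | yes refl = refl

-- Separates the exponents of x and θ. `does (a ℕ.≟ b)` computes to `a ≡ᵇ b`, and `suc a ≡ᵇ suc c`
-- to `a ≡ᵇ c`; the induction in `∑-upTo-split` relies on this.
δ₁-factor : ∀ a e b f → δ₁ (a , e) (b , f) ≡ ⟦ a ≡ᵇ b ⟧ * ⟦ does (e Bool.≟ f) ⟧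
δ₁-factor a e b f = trans (cong ⟦_⟧ (does-×-≡-dec ℕ._≟_ Bool._≟_ a b e f)) (⟦∧⟧ (a ≡ᵇ b) _)

δ₁-support : ∀ p q → δ₁ p q ≡ 0ℚ ⊎ p ≡ q
δ₁-support p q with ×-≡-dec ℕ._≟_ Bool._≟_ p q
... | no _    = inj₁ refl
... | yes p≡q = inj₂ p≡q

-- The coefficient, up to sign, of q in the product of two powers of (x₁, θ₁).
productCoeff : Power → Power → Power → ℚ
productCoeff (a , e) (b , f) q = if e ∧ f then 0ℚ else δ₁ (a ℕ.+ b , e ∨ f) q

-- Only `c = a` can contribute, and it is in range exactly when `a ≤ k`. Since `c ≤ k`, the
-- truncated difference is a true one.
∑-upTo-split : ∀ a b k →
  ∑ (upTo (suc k)) (λ c → ⟦ a ≡ᵇ c ⟧ * ⟦ b ≡ᵇ k ℕ.∸ c ⟧) ≡ ⟦ a ℕ.+ b ≡ᵇ k ⟧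
∑-upTo-split a b k = trans (cong (λ cs → f 0 + ∑ cs f) (sym (map-upTo suc k)))
  (trans (cong (f 0 +_) (∑-map (upTo k) suc f)) (cases a b k))
  where
  f : ℕ → ℚ
  f c = ⟦ a ≡ᵇ c ⟧ * ⟦ b ≡ᵇ k ℕ.∸ c ⟧

  cases : ∀ a b k → ⟦ a ≡ᵇ 0 ⟧ * ⟦ b ≡ᵇ k ⟧ +
          ∑ (upTo k) (λ c → ⟦ a ≡ᵇ suc c ⟧ * ⟦ b ≡ᵇ k ℕ.∸ suc c ⟧) ≡ ⟦ a ℕ.+ b ≡ᵇ k ⟧
  cases zero    b k       = trans
    (cong₂ _+_ (ℚ.*-identityˡ ⟦ b ≡ᵇ k ⟧) (∑-zero (upTo k) (λ c → ℚ.*-zeroˡ ⟦ b ≡ᵇ k ℕ.∸ suc c ⟧)))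
    (ℚ.+-identityʳ ⟦ b ≡ᵇ k ⟧)
  cases (suc a) b zero    = cong (_+ 0ℚ) (ℚ.*-zeroˡ ⟦ b ≡ᵇ 0 ⟧)
  -- The term `c = 0` vanishes, and the shifted sum is by computation the one for `a`, `b` and `k`.
  cases (suc a) b (suc k) = trans
    (cong₂ _+_ (ℚ.*-zeroˡ ⟦ b ≡ᵇ suc k ⟧) (∑-upTo-split a b k))
    (ℚ.+-identityˡ ⟦ a ℕ.+ b ≡ᵇ k ⟧)

-- For `e` and `f` both true no entry of `splitθ g` matches: this is θ² = 0. Signs are left to
-- `swapSign`.
∑-splitθ : ∀ e f g →
  ∑ (splitθ g) (λ (e′ , f′) → ⟦ does (e Bool.≟ e′) ⟧ * ⟦ does (f Bool.≟ f′) ⟧) ≡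
  (if e ∧ f then 0ℚ else ⟦ does (e ∨ f Bool.≟ g) ⟧)
∑-splitθ false false false = refl
∑-splitθ false false true  = refl
∑-splitθ false true  false = refl
∑-splitθ false true  true  = refl
∑-splitθ true  false false = refl
∑-splitθ true  false true  = refl
∑-splitθ true  true  false = refl
∑-splitθ true  true  true  = refl

-- A split of a power chooses the exponents of x and of θ independently, so the sum is a product of
-- two sums.
∑-splitPower : ∀ r s q →
  ∑ (splitPower q) (λ (r′ , s′) → δ₁ r r′ * δ₁ s s′) ≡ productCoeff r s q
∑-splitPower (a , e) (b , f) (k , g) = begin
  ∑ (splitPower (k , g)) (λ (r′ , s′) → δ₁ (a , e) r′ * δ₁ (b , f) s′)
    ≡⟨ ∑-cartesianProductWith _ (upTo (suc k)) (splitθ g) _ ⟩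
  ∑ (upTo (suc k)) (λ c → ∑ (splitθ g) (λ (e′ , f′) →
    δ₁ (a , e) (c , e′) * δ₁ (b , f) (k ℕ.∸ c , f′)))
    ≡⟨ ∑-cong (upTo (suc k)) (λ c → ∑-cong (splitθ g) (λ (e′ , f′) →
         trans (cong₂ _*_ (δ₁-factor a e c e′) (δ₁-factor b f (k ℕ.∸ c) f′))
               (*-interchange ⟦ a ≡ᵇ c ⟧ _ _ _))) ⟩
  ∑ (upTo (suc k)) (λ c → ∑ (splitθ g) (λ t → x c * θ t))
    ≡⟨ ∑-product (upTo (suc k)) (splitθ g) x θ ⟩
  ∑ (upTo (suc k)) x * ∑ (splitθ g) θ
    ≡⟨ cong₂ _*_ (∑-upTo-split a b k) (∑-splitθ e f g) ⟩
  ⟦ a ℕ.+ b ≡ᵇ k ⟧ * (if e ∧ f then 0ℚ else ⟦ does (e ∨ f Bool.≟ g) ⟧)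
    ≡⟨ collect (e ∧ f) ⟩
  productCoeff (a , e) (b , f) (k , g) ∎
  where
  x : ℕ → ℚ
  x c = ⟦ a ≡ᵇ c ⟧ * ⟦ b ≡ᵇ k ℕ.∸ c ⟧

  θ : Bool × Bool → ℚ
  θ (e′ , f′) = ⟦ does (e Bool.≟ e′) ⟧ * ⟦ does (f Bool.≟ f′) ⟧

  collect : ∀ h → ⟦ a ℕ.+ b ≡ᵇ k ⟧ * (if h then 0ℚ else ⟦ does (e ∨ f Bool.≟ g) ⟧) ≡
                  (if h then 0ℚ else δ₁ (a ℕ.+ b , e ∨ f) (k , g))
  collect true  = ℚ.*-zeroʳ ⟦ a ℕ.+ b ≡ᵇ k ⟧
  collect false = sym (δ₁-factor (a ℕ.+ b) (e ∨ f) k g)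

-- Needs rewriting because `∧`, `+` and `∨` recurse on their left argument; on the other side,
-- `productCoeff 1ₚ (power b) q` reduces to `δ₁ (power b) q`.
productCoeff-identityʳ : ∀ r q → productCoeff r 1ₚ q ≡ δ₁ r q
productCoeff-identityʳ (a , e) q
  rewrite Bool.∧-zeroʳ e | ℕ.+-identityʳ a | Bool.∨-identityʳ e = refl

productCoeff-⊕ : ∀ a b q → ¬ (Dotted a × Dotted b) →
                 productCoeff (power a) (power b) q ≡ δ₁ (power (a ⊕ b)) q
productCoeff-⊕ (plain _)  (plain _)  q _    = refl
productCoeff-⊕ (plain _)  (dotted _) q _    = refl
productCoeff-⊕ (dotted _) (plain _)  q _    = refl
productCoeff-⊕ (dotted _) (dotted _) q ¬dot = contradiction (tt , tt) ¬dot

-- Here θ₁² = 0, which is why no diagonal step crosses a dot.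
productCoeff-dotted : ∀ a b q → Dotted a × Dotted b → productCoeff (power a) (power b) q ≡ 0ℚ
productCoeff-dotted (dotted _) (dotted _) q _ = refl

-- The product of monomial quasisymmetric functions

-- The possible powers of (x₁, θ₁) in M α, with the index of the remaining factor.
heads : DottedComposition → List (Power × DottedComposition)
heads []      = (1ₚ , []) ∷ []
heads (a ∷ α) = (1ₚ , a ∷ α) ∷ (power a , α) ∷ []

-- Gives the empty and the non-empty composition one common form, so that the recursion for the
-- product needs no case distinction.
coeffM-heads : ∀ α {n} q (m : Monomial n) →
               coeffM α (q ∷ m) ≡ ∑ (heads α) (λ (r , α′) → δ₁ r q * coeffM α′ m)
coeffM-heads []      q m = trans (coeffM-[] q m) (sym (ℚ.+-identityʳ _))
coeffM-heads (a ∷ α) q m = begin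
  coeffM (a ∷ α) (q ∷ m)        ≡⟨ coeffM-∷ a α q m ⟩
  x + y                         ≡⟨ ℚ.+-comm x y ⟩
  y + x                         ≡⟨ cong (y +_) (ℚ.+-identityʳ x) ⟨
  y + (x + 0ℚ)                  ∎
  where
  x = δ₁ (power a) q * coeffM α m
  y = δ₁ 1ₚ q * coeffM (a ∷ α) m

-- Degree in θ of the terms of a monomial quasisymmetric function

dottedParts : DottedComposition → ℕ
dottedParts []      = 0
dottedParts (a ∷ α) = (if η a then 1 else 0) ℕ.+ dottedParts α

headTerm-support : ∀ γ p q {n} (u : Monomial n) → coeffM γ u ≡ 0ℚ ⊎ degθ u ≡ dottedParts γ →
  δ₁ p q * coeffM γ u ≡ 0ℚ ⊎ degθ (q ∷ u) ≡ (if proj₂ p then 1 else 0) ℕ.+ dottedParts γ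
headTerm-support γ p q u s with δ₁-support p q | s
... | inj₁ z    | _      = inj₁ (trans (cong (_* coeffM γ u) z) (ℚ.*-zeroˡ (coeffM γ u)))
... | inj₂ _    | inj₁ z = inj₁ (trans (cong (δ₁ p q *_) z) (ℚ.*-zeroʳ (δ₁ p q)))
... | inj₂ refl | inj₂ d = inj₂ (cong (_ ℕ.+_) d)

-- Each dotted part contributes one θ to every term. Hence the sign of a reordering depends on the
-- remaining composition and not on the monomial, and can leave the sums over monomials.
coeffM-support : ∀ α {n} (u : Monomial n) → coeffM α u ≡ 0ℚ ⊎ degθ u ≡ dottedParts α
coeffM-support []      []      = inj₂ refl
coeffM-support (a ∷ α) []      = inj₁ refl
coeffM-support []      (q ∷ u) with headTerm-support [] 1ₚ q u (coeffM-support [] u)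
... | inj₁ z = inj₁ (trans (coeffM-[] q u) z)
... | inj₂ d = inj₂ d
coeffM-support (a ∷ α) (q ∷ u)
  with headTerm-support α (power a) q u (coeffM-support α u)
     | headTerm-support (a ∷ α) 1ₚ q u (coeffM-support (a ∷ α) u)
-- Either summand of `coeffM-∷` may settle the degree, with the same value `dottedParts (a ∷ α)`;
-- otherwise both vanish.
... | inj₂ d | _      = inj₂ d
... | inj₁ _ | inj₂ d = inj₂ d
... | inj₁ z | inj₁ w = inj₁ (trans (coeffM-∷ a α q u) (cong₂ _+_ z w))

-- The sign of moving θᵉ, with e the exponent of θ in s, past d other θ's.
swapSign : Power → ℕ → ℚ
swapSign s d = (- 1ℚ) ^ (if proj₂ s then d else 0)

-- The common shape of both recursions: `C` stands for the coefficients in the remaining variables.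
∑-heads : DottedComposition → DottedComposition → Power →
          (DottedComposition → DottedComposition → ℚ) → ℚ
∑-heads α β q C =
  ∑ (heads α) (λ (r , α′) → ∑ (heads β) (λ (s , β′) →
    productCoeff r s q * (swapSign s (dottedParts α′) * C α′ β′)))

∑-heads-cong : ∀ α β q {C D : DottedComposition → DottedComposition → ℚ} →
               (∀ γ δ → C γ δ ≡ D γ δ) → ∑-heads α β q C ≡ ∑-heads α β q D
∑-heads-cong α β q eq =
  ∑-cong (heads α) (λ (r , α′) → ∑-cong (heads β) (λ (s , β′) →
    cong (λ c → productCoeff r s q * (swapSign s (dottedParts α′) * c)) (eq α′ β′)))

-- The inversions of `r ∷ u` and `s ∷ v` are those of `u` and `v`, plus the θ's of `u` passed by the
-- θ of `s`; so the sign is a product.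
mulTerm-heads : ∀ α β {n} r s (u v : Monomial n) →
  mulTerm (M α) (M β) (r ∷ u , s ∷ v) ≡
  ∑ (heads α) (λ (r′ , α′) → ∑ (heads β) (λ (s′ , β′) →
    (δ₁ r′ r * δ₁ s′ s) * (swapSign s′ (dottedParts α′) * mulTerm (M α′) (M β′) (u , v))))
mulTerm-heads α β r s u v = begin
  k * (coeffM α (r ∷ u) * coeffM β (s ∷ v))
    ≡⟨ cong (k *_) (cong₂ _*_ (coeffM-heads α r u) (coeffM-heads β s v)) ⟩
  k * (∑ (heads α) f * ∑ (heads β) g)
    ≡⟨ cong (k *_) (∑-product (heads α) (heads β) f g) ⟨
  k * ∑ (heads α) (λ x → ∑ (heads β) (λ y → f x * g y))
    ≡⟨ ∑-* (heads α) k _ ⟨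
  ∑ (heads α) (λ x → k * ∑ (heads β) (λ y → f x * g y))
    ≡⟨ ∑-cong (heads α) (λ x → trans (sym (∑-* (heads β) k _)) (∑-cong (heads β) (term≡ x))) ⟩
  ∑ (heads α) (λ (r′ , α′) → ∑ (heads β) (λ (s′ , β′) →
    (δ₁ r′ r * δ₁ s′ s) * (swapSign s′ (dottedParts α′) * mulTerm (M α′) (M β′) (u , v)))) ∎
  where
  k = (- 1ℚ) ^ inversions (r ∷ u) (s ∷ v)
  i = (- 1ℚ) ^ inversions u v

  f g : Power × DottedComposition → ℚ
  f (r′ , α′) = δ₁ r′ r * coeffM α′ u
  g (s′ , β′) = δ₁ s′ s * coeffM β′ v

  open +-*-Solver

  regroup : ∀ w i x a y b → (w * i) * ((x * a) * (y * b)) ≡ (x * y) * (w * (i * (a * b)))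
  regroup = solve 6 (λ w i x a y b →
    (w :* i) :* ((x :* a) :* (y :* b)) := (x :* y) :* (w :* (i :* (a :* b)))) refl

  -- The two signs can differ only where a coefficient is zero, and there both sides vanish. The
  -- coefficients are variables so that equations with `0ℚ` can be matched with `refl`.
  swapSign≡ : ∀ s′ α′ x a → a ≡ 0ℚ ⊎ degθ u ≡ dottedParts α′ → ∀ y → y ≡ 0ℚ ⊎ s′ ≡ s → ∀ b →
    (x * y) * (swapSign s (degθ u) * (i * (a * b))) ≡
    (x * y) * (swapSign s′ (dottedParts α′) * (i * (a * b)))
  swapSign≡ s′ α′ x a _           y (inj₁ refl) b =
    trans (vanish (swapSign s (degθ u) * _)) (sym (vanish (swapSign s′ (dottedParts α′) * _)))
    where
    vanish : ∀ z → (x * 0ℚ) * z ≡ 0ℚ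
    vanish z = trans (cong (_* z) (ℚ.*-zeroʳ x)) (ℚ.*-zeroˡ z)
  swapSign≡ s′ α′ x a (inj₁ refl) y (inj₂ _)    b =
    cong (x * y *_) (trans (vanish (swapSign s (degθ u)))
                           (sym (vanish (swapSign s′ (dottedParts α′)))))
    where
    vanish : ∀ w → w * (i * (0ℚ * b)) ≡ 0ℚ
    vanish w = trans (cong (λ z → w * (i * z)) (ℚ.*-zeroˡ b))
                     (trans (cong (w *_) (ℚ.*-zeroʳ i)) (ℚ.*-zeroʳ w))
  swapSign≡ s′ α′ x a (inj₂ d)    y (inj₂ refl) b =
    cong (λ d → x * y * (swapSign s d * (i * (a * b)))) d

  term≡ : ∀ x y → let (r′ , α′) = x; (s′ , β′) = y in k * (f x * g y) ≡
    (δ₁ r′ r * δ₁ s′ s) * (swapSign s′ (dottedParts α′) * mulTerm (M α′) (M β′) (u , v))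
  term≡ (r′ , α′) (s′ , β′) = begin
    k * (f (r′ , α′) * g (s′ , β′))
      ≡⟨ cong (_* (f (r′ , α′) * g (s′ , β′)))
              (^-homo-* (- 1ℚ) (if proj₂ s then degθ u else 0) (inversions u v)) ⟩
    (swapSign s (degθ u) * i) * (f (r′ , α′) * g (s′ , β′))
      ≡⟨ regroup (swapSign s (degθ u)) i (δ₁ r′ r) (coeffM α′ u) (δ₁ s′ s) (coeffM β′ v) ⟩
    (δ₁ r′ r * δ₁ s′ s) * (swapSign s (degθ u) * (i * (coeffM α′ u * coeffM β′ v)))
      ≡⟨ swapSign≡ s′ α′ (δ₁ r′ r) (coeffM α′ u) (coeffM-support α′ u)
                   (δ₁ s′ s) (δ₁-support s′ s) (coeffM β′ v) ⟩
    (δ₁ r′ r * δ₁ s′ s) * (swapSign s′ (dottedParts α′) * mulTerm (M α′) (M β′) (u , v)) ∎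

-- A factorisation of `q ∷ m` is a split of `q` together with a factorisation of `m`. The sums over
-- `heads` are moved outside these two.
coeff-*ₛ-∷ : ∀ α β {n} q (m : Monomial n) →
  coeff (M α *ₛ M β) (q ∷ m) ≡ ∑-heads α β q (λ α′ β′ → coeff (M α′ *ₛ M β′) m)
coeff-*ₛ-∷ α β q m = begin
  coeff (M α *ₛ M β) (q ∷ m)
    ≡⟨ ∑-cartesianProductWith _ Q F (mulTerm (M α) (M β)) ⟩
  ∑ Q (λ (r , s) → ∑ F (λ (u , v) → mulTerm (M α) (M β) (r ∷ u , s ∷ v)))
    ≡⟨ ∑-cong Q (λ (r , s) → ∑-cong F (λ (u , v) → mulTerm-heads α β r s u v)) ⟩
  ∑ Q (λ p → ∑ F (λ t → ∑ (heads α) (λ x → ∑ (heads β) (λ y → X x y p * Y x y t))))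
    ≡⟨ ∑-cong Q (λ p → trans (∑-comm F (heads α) _)
                             (∑-cong (heads α) (λ x → ∑-comm F (heads β) _))) ⟩
  ∑ Q (λ p → ∑ (heads α) (λ x → ∑ (heads β) (λ y → ∑ F (λ t → X x y p * Y x y t))))
    ≡⟨ trans (∑-comm Q (heads α) _) (∑-cong (heads α) (λ x → ∑-comm Q (heads β) _)) ⟩
  ∑ (heads α) (λ x → ∑ (heads β) (λ y → ∑ Q (λ p → ∑ F (λ t → X x y p * Y x y t))))
    -- For fixed heads, `X` depends on the split of `q` only and `Y` on the factorisation of `m`
    -- only, so the double sum factors.
    ≡⟨ ∑-cong (heads α) (λ (r , α′) → ∑-cong (heads β) (λ (s , β′) →
         trans (∑-product Q F _ _)
               (cong₂ _*_ (∑-splitPower r s q)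
                          (∑-* F (swapSign s (dottedParts α′)) (mulTerm (M α′) (M β′)))))) ⟩
  ∑-heads α β q (λ α′ β′ → coeff (M α′ *ₛ M β′) m) ∎
  where
  Q = splitPower q
  F = factorisations m

  X : Power × DottedComposition → Power × DottedComposition → Power × Power → ℚ
  X (r , _) (s , _) (r′ , s′) = δ₁ r r′ * δ₁ s s′

  Y : Power × DottedComposition → Power × DottedComposition → Monomial _ × Monomial _ → ℚ
  Y (_ , α′) (s , β′) t = swapSign s (dottedParts α′) * mulTerm (M α′) (M β′) t

-- Dots below a path

module _ {P : Pred C 0ℓ} (P? : Decidable P) where

  length-filter-map-tabulate : ∀ {n} (f : B → C) (g : Fin n → B) →
    length (filter P? (map f (tabulate g))) ≡
    sum (λ j → if does (P? (f (g j))) then 1 else 0)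
  length-filter-map-tabulate {n = zero}  f g = refl
  length-filter-map-tabulate {n = suc n} f g with does (P? (f (g zero)))
  ... | true  = cong suc (length-filter-map-tabulate f (g ∘ suc))
  ... | false = length-filter-map-tabulate f (g ∘ suc)

-- `allFin` is `tabulate` of the identity; general `f` and `g` are needed because the tail of
-- `tabulate f` is `tabulate (f ∘ suc)`.
length-filter-cartesianProduct : ∀ {P : Pred (A × B) 0ℓ} (P? : Decidable P) {m n}
  (f : Fin m → A) (g : Fin n → B) →
  length (filter P? (cartesianProduct (tabulate f) (tabulate g))) ≡
  sum (λ i → sum (λ j → if does (P? (f i , g j)) then 1 else 0))
length-filter-cartesianProduct P? {zero}  f g = refl
length-filter-cartesianProduct P? {suc m} f g = begin
  length (filter P? (row ++ rest))
    ≡⟨ cong length (filter-++ P? row rest) ⟩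
  length (filter P? row ++ filter P? rest)
    ≡⟨ length-++ (filter P? row) ⟩
  length (filter P? row) ℕ.+ length (filter P? rest)
    ≡⟨ cong₂ ℕ._+_ (length-filter-map-tabulate P? (f zero ,_) g)
                   (length-filter-cartesianProduct P? (f ∘ suc) g) ⟩
  sum (λ i → sum (λ j → if does (P? (f i , g j)) then 1 else 0)) ∎
  where
  row  = map (f zero ,_) (tabulate g)
  rest = cartesianProduct (tabulate (f ∘ suc)) (tabulate g)

-- In this form the first column and the first row split off by computation.
dotsBelow-sum : ∀ {α β} (P : OverlappingShuffle α β) →
  dotsBelow P ≡ sum (λ q → sum (λ p → if does (dotBelow? P (q , p)) then 1 else 0))
dotsBelow-sum P = length-filter-cartesianProduct (dotBelow? P) (λ q → q) (λ p → p)

-- For the lowest row when the path passes above it in every column: the test `0 < suc h` has become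
-- `true`, and `e` tells whether the label of the row is dotted.
dotsInRow : ∀ α e → sum (λ q → if (η (lookup α q) ∧ e) ∧ true then 1 else 0) ≡
                    (if e then dottedParts α else 0)
dotsInRow []      false = refl
dotsInRow []      true  = refl
dotsInRow (a ∷ α) false rewrite Bool.∧-zeroʳ (η a) = dotsInRow α false
dotsInRow (a ∷ α) true
  -- The first rewrite removes the inner `true`, the second the outer one.
  rewrite Bool.∧-identityʳ (η a) | Bool.∧-identityʳ (η a) = cong (_ ℕ.+_) (dotsInRow α true)

-- For a column entered at ordinate 0, where the test `p < 0` computes to `false`.
noDotsBelow : ∀ a β → sum (λ p → if (η a ∧ η (lookup β p)) ∧ false then 1 else 0) ≡ 0
noDotsBelow a β = trans
  (sum-cong-≗ (λ p → cong (if_then 1 else 0) (Bool.∧-zeroʳ (η a ∧ η (lookup β p)))))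
  (sum-replicate-zero (length β))

-- The new lowest row lies wholly below the raised path; for the other rows `suc p < suc h` computes
-- to `p < h`, which leaves the dots below `P`.
raisedDots : ∀ {α β} b (P : OverlappingShuffle α β) →
  sum (λ q → sum (λ p → if (η (lookup α q) ∧ η (lookup (b ∷ β) p)) ∧
                           does (toℕ p ℕ.<? suc (height P q)) then 1 else 0)) ≡
  (if η b then dottedParts α else 0) ℕ.+ dotsBelow P
raisedDots {α} b P = trans (∑-distrib-+ (λ q → if (η (lookup α q) ∧ η b) ∧ true then 1 else 0) _)
  (cong₂ ℕ._+_ (dotsInRow α (η b)) (sym (dotsBelow-sum P)))

dotsBelow-right : ∀ {a α β} (P : OverlappingShuffle α β) → dotsBelow (right {a} P) ≡ dotsBelow P
dotsBelow-right {a} {β = β} P = trans (dotsBelow-sum (right {a} P))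
  (cong₂ ℕ._+_ (noDotsBelow a β) (sym (dotsBelow-sum P)))

dotsBelow-up : ∀ {b α β} (P : OverlappingShuffle α β) →
  dotsBelow (up {b} P) ≡ (if η b then dottedParts α else 0) ℕ.+ dotsBelow P
dotsBelow-up {b} P = trans (dotsBelow-sum (up {b} P)) (raisedDots b P)

-- The first column is entered at ordinate 0 and contributes nothing; over the other columns the
-- path is raised by one row.
dotsBelow-diag : ∀ {a b α β} .(¬dot : ¬ (Dotted a × Dotted b)) (P : OverlappingShuffle α β) →
  dotsBelow (diag ¬dot P) ≡ (if η b then dottedParts α else 0) ℕ.+ dotsBelow P
dotsBelow-diag {a} {b} {β = β} ¬dot P = trans (dotsBelow-sum (diag ¬dot P))
  (cong₂ ℕ._+_ (noDotsBelow a (b ∷ β)) (raisedDots b P))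

sign-right : ∀ {a α β} (P : OverlappingShuffle α β) → sign (right {a} P) ≡ sign P
sign-right P = cong ((- 1ℚ) ^_) (dotsBelow-right P)

sign-up : ∀ {b α β} (P : OverlappingShuffle α β) →
          sign (up {b} P) ≡ swapSign (power b) (dottedParts α) * sign P
sign-up {b} {α} P = trans (cong ((- 1ℚ) ^_) (dotsBelow-up P))
  (^-homo-* (- 1ℚ) (if η b then dottedParts α else 0) (dotsBelow P))

sign-diag : ∀ {a b α β} .(¬dot : ¬ (Dotted a × Dotted b)) (P : OverlappingShuffle α β) →
            sign (diag ¬dot P) ≡ swapSign (power b) (dottedParts α) * sign P
sign-diag {b = b} {α} ¬dot P = trans (cong ((- 1ℚ) ^_) (dotsBelow-diag ¬dot P))
  (^-homo-* (- 1ℚ) (if η b then dottedParts α else 0) (dotsBelow P))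

-- The signed sum over overlapping shuffles

signedCoeff : ∀ {n} → Monomial n → ∀ {α β} → OverlappingShuffle α β → ℚ
signedCoeff m P = sign P * coeffM (Γ P) m

shuffleCoeff : DottedComposition → DottedComposition → ∀ {n} → Monomial n → ℚ
shuffleCoeff α β m = ∑ (overlappingShuffles α β) (signedCoeff m)

-- By `coeffM-∷`, the first pair of variables carries `c` or nothing. If it carries `c`, the step is
-- used up and leaves its sign `ε`; otherwise the path stays whole, hence the sum over
-- `map step Ps`.
∑-firstStep : ∀ {α β α′ β′} (step : OverlappingShuffle α β → OverlappingShuffle α′ β′) c ε →
  (∀ P → Γ (step P) ≡ c ∷ Γ P) → (∀ P → sign (step P) ≡ ε * sign P) →
  ∀ Ps {n} q (m : Monomial n) →
  ∑ (map step Ps) (signedCoeff (q ∷ m)) ≡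
  δ₁ (power c) q * (ε * ∑ Ps (signedCoeff m)) + δ₁ 1ₚ q * ∑ (map step Ps) (signedCoeff m)
∑-firstStep step c ε Γ≡ sign≡ Ps q m = begin
  ∑ (map step Ps) (signedCoeff (q ∷ m))
    ≡⟨ ∑-map Ps step _ ⟩
  ∑ Ps (λ P → signedCoeff (q ∷ m) (step P))
    ≡⟨ ∑-cong Ps term≡ ⟩
  ∑ Ps (λ P → d * (ε * signedCoeff m P) + d₁ * signedCoeff m (step P))
    ≡⟨ ∑-+ Ps _ _ ⟩
  ∑ Ps (λ P → d * (ε * signedCoeff m P)) + ∑ Ps (λ P → d₁ * signedCoeff m (step P))
    ≡⟨ cong₂ _+_ (trans (∑-* Ps d _) (cong (d *_) (∑-* Ps ε _)))
                 (trans (∑-* Ps d₁ _) (cong (d₁ *_) (sym (∑-map Ps step _)))) ⟩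
  d * (ε * ∑ Ps (signedCoeff m)) + d₁ * ∑ (map step Ps) (signedCoeff m) ∎
  where
  d  = δ₁ (power c) q
  d₁ = δ₁ 1ₚ q

  open +-*-Solver

  regroup : ∀ ε s x y d d₁ → (ε * s) * (d * x + d₁ * y) ≡ d * (ε * (s * x)) + d₁ * ((ε * s) * y)
  regroup = solve 6 (λ ε s x y d d₁ →
    (ε :* s) :* (d :* x :+ d₁ :* y) := d :* (ε :* (s :* x)) :+ d₁ :* ((ε :* s) :* y)) refl

  term≡ : ∀ P → signedCoeff (q ∷ m) (step P) ≡
                d * (ε * signedCoeff m P) + d₁ * signedCoeff m (step P)
  term≡ P rewrite Γ≡ P | sign≡ P = trans (cong (ε * sign P *_) (coeffM-∷ c (Γ P) q m))
    (regroup ε (sign P) (coeffM (Γ P) m) (coeffM (c ∷ Γ P) m) d d₁)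

-- One formula covers both cases: with a dot in the cell there is no diagonal step, and
-- `productCoeff` vanishes as well.
∑-diagonals : ∀ {a b} α β (dot? : Dec (Dotted a × Dotted b)) {n} q (m : Monomial n) →
  ∑ (diagonals α β dot?) (signedCoeff (q ∷ m)) ≡
  productCoeff (power a) (power b) q * (swapSign (power b) (dottedParts α) * shuffleCoeff α β m) +
  δ₁ 1ₚ q * ∑ (diagonals α β dot?) (signedCoeff m)
∑-diagonals {a} {b} α β (yes dot) q m
  rewrite productCoeff-dotted a b q dot
  = sym (cong₂ _+_ (ℚ.*-zeroˡ (swapSign (power b) (dottedParts α) * shuffleCoeff α β m))
                   (ℚ.*-zeroʳ (δ₁ 1ₚ q)))
∑-diagonals {a} {b} α β (no ¬dot) q m
  rewrite productCoeff-⊕ a b q ¬dot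
  = ∑-firstStep (diag ¬dot) (a ⊕ b) (swapSign (power b) (dottedParts α)) (λ _ → refl) (sign-diag ¬dot)
      (overlappingShuffles α β) q m

-- `1ₚ` and `1ℚ` give the term its shape in `∑-heads`: nothing is taken from `β`, so no θ is moved.
∑-right : ∀ a {α β} (Ps : List (OverlappingShuffle α β)) {n} q (m : Monomial n) →
  ∑ (map (right {a}) Ps) (signedCoeff (q ∷ m)) ≡
  productCoeff (power a) 1ₚ q * (1ℚ * ∑ Ps (signedCoeff m)) +
  δ₁ 1ₚ q * ∑ (map right Ps) (signedCoeff m)
∑-right a Ps q m rewrite productCoeff-identityʳ (power a) q =
  ∑-firstStep right a 1ℚ (λ _ → refl)
    (λ P → trans (sign-right P) (sym (ℚ.*-identityˡ (sign P)))) Ps q m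

∑-up : ∀ b {α β} (Ps : List (OverlappingShuffle α β)) {n} q (m : Monomial n) →
  ∑ (map (up {b}) Ps) (signedCoeff (q ∷ m)) ≡
  productCoeff 1ₚ (power b) q * (swapSign (power b) (dottedParts α) * ∑ Ps (signedCoeff m)) +
  δ₁ 1ₚ q * ∑ (map up Ps) (signedCoeff m)
∑-up b {α} Ps q m = ∑-firstStep up b (swapSign (power b) (dottedParts α)) (λ _ → refl) sign-up Ps q m

-- In `∑-heads`, a power from `α` alone is a step to the right, one from `β` alone a step up, one
-- from each a diagonal step; `1ₚ` twice leaves the path untouched.
shuffleCoeff-∷ : ∀ α β {n} q (m : Monomial n) →
  shuffleCoeff α β (q ∷ m) ≡ ∑-heads α β q (λ α′ β′ → shuffleCoeff α′ β′ m)
shuffleCoeff-∷ []      []      q m =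
  trans (cong (λ c → 1ℚ * c + 0ℚ) (coeffM-[] q m)) (regroup (δ₁ 1ₚ q) (coeffM [] m))
  where
  open +-*-Solver
  regroup : ∀ d x → 1ℚ * (d * x) + 0ℚ ≡ d * (1ℚ * (1ℚ * x + 0ℚ)) + 0ℚ + 0ℚ
  regroup = solve 2 (λ d x →
    con 1ℚ :* (d :* x) :+ con 0ℚ :=
    d :* (con 1ℚ :* (con 1ℚ :* x :+ con 0ℚ)) :+ con 0ℚ :+ con 0ℚ) refl
shuffleCoeff-∷ []      (b ∷ β) q m =
  trans (∑-up b (overlappingShuffles [] β) q m)
        (regroup (productCoeff 1ₚ (power b) q * (swapSign (power b) 0 * shuffleCoeff [] β m))
                 (δ₁ 1ₚ q) (shuffleCoeff [] (b ∷ β) m))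
  where
  open +-*-Solver
  regroup : ∀ u d x → u + d * x ≡ (d * (1ℚ * x) + (u + 0ℚ)) + 0ℚ
  regroup = solve 3 (λ u d x →
    u :+ d :* x := (d :* (con 1ℚ :* x) :+ (u :+ con 0ℚ)) :+ con 0ℚ) refl
shuffleCoeff-∷ (a ∷ α) []      q m =
  trans (∑-right a (overlappingShuffles α []) q m)
        (regroup (productCoeff (power a) 1ₚ q * (1ℚ * shuffleCoeff α [] m))
                 (δ₁ 1ₚ q) (shuffleCoeff (a ∷ α) [] m))
  where
  open +-*-Solver
  regroup : ∀ r d x → r + d * x ≡ (d * (1ℚ * x) + 0ℚ) + ((r + 0ℚ) + 0ℚ)
  regroup = solve 3 (λ r d x →
    r :+ d :* x := (d :* (con 1ℚ :* x) :+ con 0ℚ) :+ ((r :+ con 0ℚ) :+ con 0ℚ)) refl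
shuffleCoeff-∷ (a ∷ α) (b ∷ β) {n} q m = begin
  shuffleCoeff (a ∷ α) (b ∷ β) (q ∷ m)
    ≡⟨ ∑-split (q ∷ m) ⟩
  ∑ Rs (signedCoeff (q ∷ m)) + (∑ Us (signedCoeff (q ∷ m)) + ∑ Ds (signedCoeff (q ∷ m)))
    ≡⟨ cong₂ _+_ (∑-right a (overlappingShuffles α (b ∷ β)) q m)
         (cong₂ _+_ (∑-up b (overlappingShuffles (a ∷ α) β) q m)
                    (∑-diagonals α β (T? (η a) ×-dec T? (η b)) q m)) ⟩
  (r + d * ∑ Rs f) + ((u + d * ∑ Us f) + (x + d * ∑ Ds f))
    -- The three remainders with factor `d` reassemble the sum over all paths.
    ≡⟨ regroup r u x d (∑ Rs f) (∑ Us f) (∑ Ds f) ⟩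
  (d * (1ℚ * (∑ Rs f + (∑ Us f + ∑ Ds f))) + (u + 0ℚ)) + ((r + (x + 0ℚ)) + 0ℚ)
    ≡⟨ cong (λ y → (d * (1ℚ * y) + (u + 0ℚ)) + ((r + (x + 0ℚ)) + 0ℚ)) (∑-split m) ⟨
  ∑-heads (a ∷ α) (b ∷ β) q (λ α′ β′ → shuffleCoeff α′ β′ m) ∎
  where
  Rs = map right (overlappingShuffles α (b ∷ β))
  Us = map up (overlappingShuffles (a ∷ α) β)
  Ds = diagonals {a} {b} α β (T? (η a) ×-dec T? (η b))

  f : OverlappingShuffle (a ∷ α) (b ∷ β) → ℚ
  f = signedCoeff m

  d = δ₁ 1ₚ q
  r = productCoeff (power a) 1ₚ q * (1ℚ * shuffleCoeff α (b ∷ β) m)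
  u = productCoeff 1ₚ (power b) q *
        (swapSign (power b) (dottedParts (a ∷ α)) * shuffleCoeff (a ∷ α) β m)
  x = productCoeff (power a) (power b) q *
        (swapSign (power b) (dottedParts α) * shuffleCoeff α β m)

  ∑-split : ∀ {n} (m : Monomial n) → shuffleCoeff (a ∷ α) (b ∷ β) m ≡
            ∑ Rs (signedCoeff m) + (∑ Us (signedCoeff m) + ∑ Ds (signedCoeff m))
  ∑-split m = trans (∑-++ Rs (Us ++ Ds) (signedCoeff m))
                    (cong (∑ Rs (signedCoeff m) +_) (∑-++ Us Ds (signedCoeff m)))

  open +-*-Solver
  regroup : ∀ r u x d R U D → (r + d * R) + ((u + d * U) + (x + d * D)) ≡
    (d * (1ℚ * (R + (U + D))) + (u + 0ℚ)) + ((r + (x + 0ℚ)) + 0ℚ)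
  regroup = solve 7 (λ r u x d R U D →
    (r :+ d :* R) :+ ((u :+ d :* U) :+ (x :+ d :* D)) :=
    (d :* (con 1ℚ :* (R :+ (U :+ D))) :+ (u :+ con 0ℚ)) :+ ((r :+ (x :+ con 0ℚ)) :+ con 0ℚ)) refl

-- Monomials without variables, and the induction

signedCoeff-[]-∷ˡ : ∀ {a α β} (P : OverlappingShuffle (a ∷ α) β) → signedCoeff [] P ≡ 0ℚ
-- The patterns expose the first step, which makes `Γ P` non-empty; a non-empty composition has no
-- term in zero variables.
signedCoeff-[]-∷ˡ P@(right _)  = ℚ.*-zeroʳ (sign P)
signedCoeff-[]-∷ˡ P@(up _)     = ℚ.*-zeroʳ (sign P)
signedCoeff-[]-∷ˡ P@(diag _ _) = ℚ.*-zeroʳ (sign P)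

signedCoeff-[]-∷ʳ : ∀ {b α β} (P : OverlappingShuffle α (b ∷ β)) → signedCoeff [] P ≡ 0ℚ
signedCoeff-[]-∷ʳ P@(right _)  = ℚ.*-zeroʳ (sign P)
signedCoeff-[]-∷ʳ P@(up _)     = ℚ.*-zeroʳ (sign P)
signedCoeff-[]-∷ʳ P@(diag _ _) = ℚ.*-zeroʳ (sign P)

-- Induction on the number of variables: one term of the recursion keeps both `α` and `β`, so their
-- lengths need not decrease.
coeff-*ₛ : ∀ α β {n} (m : Monomial n) → coeff (M α *ₛ M β) m ≡ shuffleCoeff α β m
coeff-*ₛ []      []      [] = refl
coeff-*ₛ []      (b ∷ β) [] = sym (∑-zero (overlappingShuffles [] (b ∷ β)) signedCoeff-[]-∷ʳ)
coeff-*ₛ (a ∷ α) β       [] = begin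
  -- `coeffM β []` does not reduce for a variable `β`, so the product with `0ℚ` has to be removed by
  -- hand.
  1ℚ * (0ℚ * coeffM β []) + 0ℚ ≡⟨ cong (λ c → 1ℚ * c + 0ℚ) (ℚ.*-zeroˡ (coeffM β [])) ⟩
  0ℚ                           ≡⟨ ∑-zero (overlappingShuffles (a ∷ α) β) signedCoeff-[]-∷ˡ ⟨
  shuffleCoeff (a ∷ α) β []    ∎
coeff-*ₛ α β (q ∷ m) = begin
  coeff (M α *ₛ M β) (q ∷ m)
    ≡⟨ coeff-*ₛ-∷ α β q m ⟩
  ∑-heads α β q (λ α′ β′ → coeff (M α′ *ₛ M β′) m)
    ≡⟨ ∑-heads-cong α β q (λ α′ β′ → coeff-*ₛ α′ β′ m) ⟩
  ∑-heads α β q (λ α′ β′ → shuffleCoeff α′ β′ m)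
    ≡⟨ shuffleCoeff-∷ α β q m ⟨
  shuffleCoeff α β (q ∷ m) ∎

proposition5p5 : (α β : DottedComposition) →
    M α *ₛ M β ≈ ∑ₛ (overlappingShuffles α β) (λ P → sign P • M (Γ P))
proposition5p5 α β m = trans (coeff-*ₛ α β m)
  (sym (coeff-∑ₛ (overlappingShuffles α β) (λ P → sign P • M (Γ P)) m))
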